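{- Let $f$ and $g$ be as defined in the context, and assume that (i) $f(n,a)=f(n+1,a)$ for all $a,n\in\mathbb{N}^+$ with $n\ge\lceil\log_2 a\rceil+1$, and (ii) $g(n,m)=g(n+1,m)$ for all $m,n\in\mathbb{N}^+$ with $m\ge 2$ and $n\ge\lceil\log_2 m\rceil$. Then every union-closed family $\mathcal{F}$ with $m$ sets contains an element lying in at least $\frac{6}{13}m$ sets of the family, i.e. $a(\mathcal{F})\ge\frac{6}{13}m(\mathcal{F})$.
   Context: A family $\mathcal{F}$ on ground set $[n]=\{1,\dots,n\}$ is a collection $\mathcal{S}(\mathcal{F})$ of distinct subsets of $[n]$ (elements of $[n]$ may lie in no set); $m(\mathcal{F})=|\mathcal{S}(\mathcal{F})|$. It is union-closed if $S\cup T\in\mathcal{S}(\mathcal{F})$ whenever $S,T\in\mathcal{S}(\mathcal{F})$. For $e\in[n]$, $m_e(\mathcal{F})$ is the number of sets of $\mathcal{F}$ containing $e$, and $a(\mathcal{F})=\max_{e\in[n]}m_e(\mathcal{F})$. For $n,a\in\mathbb{N}^+$, $f(n,a)$ is the maximum of $m(\mathcal{F})$ over all union-closed families $\mathcal{F}$ on ground set $[n]$ with $\mathcal{S}(\mathcal{F})\neq\emptyset$ and $a(\mathcal{F})\le a$. For $n,m\in\mathbb{N}^+$ with $m\ge2$ and $m\le 2^n$, $g(n,m)$ is the minimum of $a(\mathcal{F})$ over all union-closed families $\mathcal{F}$ on ground set $[n]$ with $m(\mathcal{F})=m$.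
   Formalization: The claim is proved for union-closed families with at least 2 sets (the domain of g); as worded it fails for the one-set family {∅}, which has m = 1 while no element lies in any set. -}

module Defs where

open import Data.Nat using (ℕ; suc; _≤_; _+_; _*_)
open import Data.Fin using (Fin)
open import Data.Fin.Subset using (Subset; _∪_)
open import Data.Fin.Subset.Properties using (_∈?_)
open import Data.List using (List; length; filter)
open import Data.List.Membership.Propositional renaming (_∈_ to _∈ₗ_)
open import Data.List.Relation.Unary.Unique.Propositional using (Unique)
open import Data.Product using (Σ; ∃; _×_)
open import Relation.Binary.PropositionalEquality using (_≡_)

record Family (n : ℕ) : Set where
  constructor family
  field
    sets     : List (Subset n)
    distinct : Unique sets
open Family public

m : ∀ {n} → Family n → ℕ
m F = length (sets F)

mₑ : ∀ {n} → Family n → Fin n → ℕ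
mₑ F e = length (filter (e ∈?_) (sets F))

UnionClosed : ∀ {n} → Family n → Set
UnionClosed F = ∀ {S T} → S ∈ₗ sets F → T ∈ₗ sets F → (S ∪ T) ∈ₗ sets F

IsA : ∀ {n} → Family n → ℕ → Set
IsA F k = (∃ λ e → mₑ F e ≡ k) × (∀ e → mₑ F e ≤ k)

AdmissibleF : (n a : ℕ) → Family n → Set
AdmissibleF n a F = UnionClosed F × 1 ≤ m F × (∀ e → mₑ F e ≤ a)

IsF : ℕ → ℕ → ℕ → Set
IsF n a k = (Σ (Family n) λ F → AdmissibleF n a F × m F ≡ k)
          × (∀ (F : Family n) → AdmissibleF n a F → m F ≤ k)

IsG : ℕ → ℕ → ℕ → Set
IsG n mm k = (Σ (Family n) λ F → UnionClosed F × m F ≡ mm × IsA F k)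
           × (∀ (F : Family n) → UnionClosed F → m F ≡ mm → ∀ j → IsA F j → k ≤ j)

{-# OPTIONS --safe #-}
module Submission where

-- Stability of g moves an extremal family to a ground set with n ≤ ⌈log₂ m⌉, so that it fills
-- more than half of the cube, and there Karpas's argument yields an element in at least half
-- of the sets. Let N = 2ⁿ and c e = m - 2 mₑ, the (scaled) linear Fourier coefficients of the
-- indicator. A set outside a union-closed family covers at most one member, so at most N - m
-- edges of the cube leave the family upwards; as the upward minus the downward boundary edges
-- number ∑ c e, this bounds the edge boundary by 2 (N - m) - ∑ c e. Weighing Fourier levels
-- bounds it from below, and for m > N / 2 the two bounds give N ∑ c e ≤ 2 ∑ (c e)², which
-- is impossible when 0 < 2 c e < N for every e.

open import Defs
open import Data.Nat using (ℕ; zero; suc; _^_; z≤n; s≤s)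
import Data.Nat as ℕ
import Data.Nat.Properties as ℕ
open import Data.Nat.Induction using (<-rec)
open import Data.Nat.Logarithm using (⌈log₂_⌉; ⌈log₂⌉-mono-≤; ⌈log₂2^n⌉≡n)
open import Data.Integer using (ℤ; +_; 0ℤ; 1ℤ; +≤+; +<+)
import Data.Integer as ℤ
import Data.Integer.Properties as ℤ
open import Data.Integer.Tactic.RingSolver using (solve-∀)
open import Algebra.Properties.CommutativeMonoid.Sum ℤ.+-0-commutativeMonoid using (sum; ∑-distrib-+; sum-cong-≗)
open import Data.Bool using (Bool; true; false)
import Data.Bool.Properties as Bool
open import Data.Empty using (⊥)
open import Data.Fin using (Fin; zero; suc)
open import Data.Fin.Properties using (any?)
open import Data.Fin.Subset using (Subset; _∪_; inside; outside)
open import Data.Fin.Subset.Properties using (_∈?_; ∪-idem)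
open import Data.List using (List; []; _∷_; length; filter; foldr)
import Data.List.Membership.DecPropositional as DecMembership
open import Data.List.Membership.Propositional renaming (_∈_ to _∈ₗ_)
open import Data.List.Relation.Unary.All.Properties using (All¬⇒¬Any)
open import Data.List.Relation.Unary.AllPairs using ([]; _∷_)
open import Data.List.Relation.Unary.Unique.Propositional using (Unique)
open import Data.Product using (∃; Σ; _×_; _,_; proj₁; proj₂; map₂)
open import Data.Sum using (inj₁; inj₂)
open import Data.Vec using ([]; _∷_)
open import Data.Vec.Properties using (≡-dec)
open import Function using (_∘_)
open import Relation.Binary.Definitions using (DecidableEquality)
open import Relation.Binary.PropositionalEquality using (_≡_; refl; sym; trans; cong; cong₂; subst; _≗_; module ≡-Reasoning)
open import Relation.Nullary using (¬_; Dec; yes; no; does; contradiction)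
open import Relation.Nullary.Decidable using (decidable-stable; dec-true; dec-false)

private
  variable
    n : ℕ

module Cube where

  open import Data.Integer using (_+_; _*_; _-_; -_; _≤_; _<_)

  0≤+ : ∀ {i j} → 0ℤ ≤ i → 0ℤ ≤ j → 0ℤ ≤ i + j
  0≤+ = ℤ.+-mono-≤

  0≤* : ∀ {i j} → 0ℤ ≤ i → 0ℤ ≤ j → 0ℤ ≤ i * j
  0≤* {+ a} {+ b} _ _ = subst (0ℤ ≤_) (ℤ.pos-* a b) (+≤+ z≤n)

  0≤square : ∀ i → 0ℤ ≤ i * i
  0≤square (+ zero)      = +≤+ z≤n
  0≤square (+ suc _)     = +≤+ z≤n
  0≤square ℤ.-[1+ _ ]    = +≤+ z≤n

  -- Functions on the cube

  lo hi plus minus : (Subset (suc n) → ℤ) → Subset n → ℤ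
  lo f x    = f (outside ∷ x)
  hi f x    = f (inside ∷ x)
  plus f x  = lo f x + hi f x
  minus f x = lo f x - hi f x

  total : (Subset n → ℤ) → ℤ
  total {zero}  f = f []
  total {suc n} f = total (lo f) + total (hi f)

  total-cong : {f g : Subset n → ℤ} → f ≗ g → total f ≡ total g
  total-cong {zero}  f≗g = f≗g []
  total-cong {suc n} f≗g = cong₂ _+_ (total-cong (λ x → f≗g (outside ∷ x))) (total-cong (λ x → f≗g (inside ∷ x)))

  total-+ : (f g : Subset n → ℤ) → total (λ x → f x + g x) ≡ total f + total g
  total-+ {zero}  f g = refl
  total-+ {suc n} f g = trans (cong₂ _+_ (total-+ (lo f) (lo g)) (total-+ (hi f) (hi g))) 
      (swap (total (lo f)) (total (lo g)) (total (hi f)) (total (hi g)))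
    where
    swap : ∀ a b c d → (a + b) + (c + d) ≡ (a + c) + (b + d)
    swap = solve-∀

  total-* : ∀ c (f : Subset n → ℤ) → total (λ x → c * f x) ≡ c * total f
  total-* {zero}  c f = refl
  total-* {suc n} c f = trans (cong₂ _+_ (total-* c (lo f)) (total-* c (hi f))) (sym (ℤ.*-distribˡ-+ c _ _))

  total-- : (f g : Subset n → ℤ) → total (λ x → f x - g x) ≡ total f - total g
  total-- f g = trans (total-cong {g = λ x → f x + - 1ℤ * g x} (λ x → to (f x) (g x)))
    (trans (total-+ f (λ x → - 1ℤ * g x)) (trans (cong (λ t → total f + t) (total-* (- 1ℤ) g)) (sym (to (total f) (total g)))))
    where
    to : ∀ a b → a - b ≡ a + - 1ℤ * b
    to = solve-∀

  total-mono : {f g : Subset n → ℤ} → (∀ x → f x ≤ g x) → total f ≤ total g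
  total-mono {zero}  f≤g = f≤g []
  total-mono {suc n} f≤g = ℤ.+-mono-≤ (total-mono (λ x → f≤g (outside ∷ x))) (total-mono (λ x → f≤g (inside ∷ x)))

  total-0 : total {n} (λ _ → 0ℤ) ≡ 0ℤ
  total-0 {zero}  = refl
  total-0 {suc n} = cong₂ _+_ (total-0 {n}) (total-0 {n})

  cubeSize : ℕ → ℤ
  cubeSize n = + (2 ^ n)

  cubeSize-suc : ∀ n → cubeSize (suc n) ≡ + 2 * cubeSize n
  cubeSize-suc n = ℤ.pos-* 2 (2 ^ n)

  0≤cubeSize : ∀ n → 0ℤ ≤ cubeSize n
  0≤cubeSize n = +≤+ z≤n

  total-const : ∀ n c → total {n} (λ _ → c) ≡ c * cubeSize n
  total-const zero    c = sym (ℤ.*-identityʳ c)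
  total-const (suc n) c = trans (cong₂ _+_ (total-const n c) (total-const n c))
    (trans (double c (cubeSize n)) (cong (c *_) (sym (cubeSize-suc n))))
    where
    double : ∀ c N → c * N + c * N ≡ c * (+ 2 * N)
    double = solve-∀

  -- Squared norm and edge energy

  sqNorm : (Subset n → ℤ) → ℤ
  sqNorm f = total (λ x → f x * f x)

  -- `u` and `v` enter only up to pointwise equality because the functions met in
  -- `energy-parallelogram` become a sum and a difference only after rearranging.
  sqNorm-parallelogram : (g h u v : Subset n → ℤ) → (∀ x → u x ≡ g x + h x) → (∀ x → v x ≡ g x - h x) →
    sqNorm u + sqNorm v ≡ + 2 * (sqNorm g + sqNorm h)
  sqNorm-parallelogram g h u v u≡ v≡ = begin
    sqNorm u + sqNorm v
      ≡⟨ total-+ (λ x → u x * u x) (λ x → v x * v x) ⟨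
    total (λ x → u x * u x + v x * v x)
      ≡⟨ total-cong (λ x → pointwise (g x) (h x) (u≡ x) (v≡ x)) ⟩
    total (λ x → + 2 * (g x * g x + h x * h x))
      ≡⟨ total-* (+ 2) (λ x → g x * g x + h x * h x) ⟩
    + 2 * total (λ x → g x * g x + h x * h x)
      ≡⟨ cong (+ 2 *_) (total-+ (λ x → g x * g x) (λ x → h x * h x)) ⟩
    + 2 * (sqNorm g + sqNorm h) ∎
    where
    open ≡-Reasoning
    expand : ∀ a b → (a + b) * (a + b) + (a - b) * (a - b) ≡ + 2 * (a * a + b * b)
    expand = solve-∀
    pointwise : ∀ a b {s d} → s ≡ a + b → d ≡ a - b → s * s + d * d ≡ + 2 * (a * a + b * b)
    pointwise a b refl refl = expand a b

  -- The sum of (f x - f y)² over the edges xy of the cube: those inside the two half-cubes, then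
  -- those joining them. For an indicator it is the size of the edge boundary.
  energy : (Subset n → ℤ) → ℤ
  energy {zero}  f = 0ℤ
  energy {suc n} f = energy (lo f) + energy (hi f) + sqNorm (minus f)

  0≤energy : (f : Subset n → ℤ) → 0ℤ ≤ energy f
  0≤energy {zero}  f = ℤ.≤-refl
  0≤energy {suc n} f = 0≤+ (0≤+ (0≤energy (lo f)) (0≤energy (hi f)))
    (subst (_≤ sqNorm (minus f)) (total-0 {n}) (total-mono (λ x → 0≤square (minus f x))))

  -- Applied to the two half-cubes, this passes from `lo f` and `hi f` to `plus f` and `minus f`,
  -- which carry the Fourier coefficients at the sets without and with the first coordinate.
  energy-parallelogram : (g h : Subset n → ℤ) →
    energy (λ x → g x + h x) + energy (λ x → g x - h x) ≡ + 2 * (energy g + energy h)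
  energy-parallelogram {zero}  g h = refl
  energy-parallelogram {suc n} g h =
    regroup
      (energy (lo p)) (energy (hi p)) (sqNorm (minus p)) (energy (lo d)) (energy (hi d)) (sqNorm (minus d))
      (energy (lo g)) (energy (hi g)) (sqNorm (minus g)) (energy (lo h)) (energy (hi h)) (sqNorm (minus h))
      (energy-parallelogram (lo g) (lo h)) (energy-parallelogram (hi g) (hi h))
      (sqNorm-parallelogram (minus g) (minus h) (minus p) (minus d)
        (λ x → swap⁺ (lo g x) (lo h x) (hi g x) (hi h x)) (λ x → swap⁻ (lo g x) (lo h x) (hi g x) (hi h x)))
    where
    p d : Subset (suc n) → ℤ
    p x = g x + h x
    d x = g x - h x
    swap⁺ : ∀ a b c d → (a + b) - (c + d) ≡ (a - c) + (b - d)
    swap⁺ = solve-∀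
    swap⁻ : ∀ a b c d → (a - b) - (c - d) ≡ (a - c) - (b - d)
    swap⁻ = solve-∀
    collect : ∀ a b c d e f → (a + b + c) + (d + e + f) ≡ (a + d) + (b + e) + (c + f)
    collect = solve-∀
    factor : ∀ a b c d e f →
      + 2 * (a + b) + + 2 * (c + d) + + 2 * (e + f) ≡ + 2 * ((a + c + e) + (b + d + f))
    factor = solve-∀
    regroup : ∀ a b c d e f a′ b′ c′ d′ e′ f′ →
      a + d ≡ + 2 * (a′ + d′) → b + e ≡ + 2 * (b′ + e′) → c + f ≡ + 2 * (c′ + f′) →
      (a + b + c) + (d + e + f) ≡ + 2 * ((a′ + b′ + c′) + (d′ + e′ + f′))
    regroup a b c d e f a′ b′ c′ d′ e′ f′ p q r =
      trans (collect a b c d e f) (trans (cong₂ _+_ (cong₂ _+_ p q) r) (factor a′ d′ b′ e′ c′ f′))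

  -- Fourier level inequalities

  -- The linear Fourier coefficient at e, times 2ⁿ.
  bias : Fin n → (Subset n → ℤ) → ℤ
  bias zero    f = total (minus f)
  bias (suc e) f = bias e (plus f)

  linearWeight : (Subset n → ℤ) → ℤ
  linearWeight f = sum (λ e → bias e f * bias e f)

  -- With f̂ scaled by 2ⁿ, the right-hand side is 2 ∑ (|S| - 1) f̂(S)² over nonempty S. Sets
  -- avoiding the first coordinate are handled by `plus f`; for the others |S| - 1 counts the
  -- remaining elements, which is the weight in `energy (minus f)`.
  poincare : (f : Subset n → ℤ) →
    0ℤ ≤ cubeSize n * energy f + + 2 * (total f * total f) - + 2 * (cubeSize n * sqNorm f)
  poincare {zero}  f = ℤ.≤-reflexive (sym (vanish (f [])))
    where
    vanish : ∀ a → 1ℤ * 0ℤ + + 2 * (a * a) - + 2 * (1ℤ * (a * a)) ≡ 0ℤ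
    vanish = solve-∀
  poincare {suc n} f =
    subst (0ℤ ≤_)
      (step (cubeSize n) (total (plus f)) (total f)
        (energy (plus f)) (energy (minus f)) (energy (lo f) + energy (hi f))
        (sqNorm (plus f)) (sqNorm (minus f)) (sqNorm f) (cubeSize-suc n) (total-+ (lo f) (hi f))
        (energy-parallelogram (lo f) (hi f))
        (sqNorm-parallelogram (lo f) (hi f) (plus f) (minus f) (λ _ → refl) (λ _ → refl)))
      (0≤+ (poincare (plus f)) (0≤* (0≤cubeSize n) (0≤energy (minus f))))
    where
    identity : ∀ M s Ep Em Qp Qm →
      (M * Ep + + 2 * (s * s) - + 2 * (M * Qp)) + M * Em
        ≡ M * (Ep + Em) + + 2 * (M * Qm) + + 2 * (s * s) - + 2 * (M * (Qp + Qm))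
    identity = solve-∀
    halve : ∀ M s E Q Qm →
      M * (+ 2 * E) + + 2 * (M * Qm) + + 2 * (s * s) - + 2 * (M * (+ 2 * Q))
        ≡ (+ 2 * M) * (E + Qm) + + 2 * (s * s) - + 2 * ((+ 2 * M) * Q)
    halve = solve-∀
    step : ∀ M {N} sp s Ep Em E Qp Qm Q → N ≡ + 2 * M → sp ≡ s →
      Ep + Em ≡ + 2 * E → Qp + Qm ≡ + 2 * Q →
      (M * Ep + + 2 * (sp * sp) - + 2 * (M * Qp)) + M * Em
        ≡ N * (E + Qm) + + 2 * (s * s) - + 2 * (N * Q)
    step M s _ Ep Em E Qp Qm Q refl refl eqE eqQ = trans (identity M s Ep Em Qp Qm)
      (trans (cong₂ (λ e q → M * e + + 2 * (M * Qm) + + 2 * (s * s) - + 2 * (M * q)) eqE eqQ)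
        (halve M s E Q Qm))

  -- With f̂ scaled by 2ⁿ, the right-hand side is 2 ∑ (|S| - 2) f̂(S)² over |S| ≥ 2.
  level-one-inequality : (f : Subset n → ℤ) →
    0ℤ ≤ cubeSize n * energy f + + 2 * linearWeight f
             + + 4 * (total f * total f) - + 4 * (cubeSize n * sqNorm f)
  level-one-inequality {zero}  f = ℤ.≤-reflexive (sym (vanish (f [])))
    where
    vanish : ∀ a → 1ℤ * 0ℤ + + 2 * 0ℤ + + 4 * (a * a) - + 4 * (1ℤ * (a * a)) ≡ 0ℤ
    vanish = solve-∀
  level-one-inequality {suc n} f =
    subst (0ℤ ≤_)
      (step (cubeSize n) (total (plus f)) (total f) (total (minus f)) (linearWeight (plus f))
        (energy (plus f)) (energy (minus f)) (energy (lo f) + energy (hi f))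
        (sqNorm (plus f)) (sqNorm (minus f)) (sqNorm f) (cubeSize-suc n) (total-+ (lo f) (hi f))
        (energy-parallelogram (lo f) (hi f))
        (sqNorm-parallelogram (lo f) (hi f) (plus f) (minus f) (λ _ → refl) (λ _ → refl)))
      -- Removing the first coordinate from a set S that contains it leaves S′ with |S| - 2 = |S′| -
      -- 1, the weight of `poincare`.
      (0≤+ (level-one-inequality (plus f)) (poincare (minus f)))
    where
    identity : ∀ M s t W Ep Em Qp Qm →
      (M * Ep + + 2 * W + + 4 * (s * s) - + 4 * (M * Qp))
        + (M * Em + + 2 * (t * t) - + 2 * (M * Qm))
        ≡ M * (Ep + Em) + + 2 * (M * Qm) + + 2 * (t * t + W)
            + + 4 * (s * s) - + 4 * (M * (Qp + Qm))
    identity = solve-∀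
    halve : ∀ M s V E Q Qm →
      M * (+ 2 * E) + + 2 * (M * Qm) + + 2 * V + + 4 * (s * s) - + 4 * (M * (+ 2 * Q))
        ≡ (+ 2 * M) * (E + Qm) + + 2 * V + + 4 * (s * s) - + 4 * ((+ 2 * M) * Q)
    halve = solve-∀
    step : ∀ M {N} sp s t W Ep Em E Qp Qm Q → N ≡ + 2 * M → sp ≡ s →
      Ep + Em ≡ + 2 * E → Qp + Qm ≡ + 2 * Q →
      (M * Ep + + 2 * W + + 4 * (sp * sp) - + 4 * (M * Qp))
        + (M * Em + + 2 * (t * t) - + 2 * (M * Qm))
        ≡ N * (E + Qm) + + 2 * (t * t + W) + + 4 * (s * s) - + 4 * (N * Q)
    step M s _ t W Ep Em E Qp Qm Q refl refl eqE eqQ = trans (identity M s t W Ep Em Qp Qm)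
      (trans (cong₂ (λ e q → M * e + + 2 * (M * Qm) + + 2 * (t * t + W)
                               + + 4 * (s * s) - + 4 * (M * q)) eqE eqQ)
        (halve M s (t * t + W) E Q Qm))

  -- Indicators and characters

  χ : Bool → ℤ
  χ false = 0ℤ
  χ true  = 1ℤ

  χ-idem : ∀ b → χ b * χ b ≡ χ b
  χ-idem false = refl
  χ-idem true  = refl

  χ≤1 : ∀ b → χ b ≤ 1ℤ
  χ≤1 false = +≤+ z≤n
  χ≤1 true  = ℤ.≤-refl

  sign : Fin n → Subset n → ℤ
  sign e x = 1ℤ - + 2 * χ (does (e ∈? x))

  -- `sign e` is the character of {e}. From this closed form follow the additivity of `bias` and its
  -- expression through `mₑ`.
  bias-sign : (e : Fin n) (f : Subset n → ℤ) → bias e f ≡ total (λ x → f x * sign e x)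
  bias-sign zero f = trans (total-- (lo f) (hi f))
    (cong₂ _+_ (total-cong (λ x → sym (ℤ.*-identityʳ (lo f x))))
      (trans (negate (total (hi f))) (trans (sym (total-* (- 1ℤ) (hi f))) (total-cong (λ x → ℤ.*-comm (- 1ℤ) (hi f x))))))
    where
    negate : ∀ a → - a ≡ - 1ℤ * a
    negate = solve-∀
  bias-sign (suc e) f = trans (bias-sign e (plus f))
    (trans (total-cong (λ x → ℤ.*-distribʳ-+ (sign e x) (lo f x) (hi f x)))
      (total-+ (λ x → lo f x * sign e x) (λ x → hi f x * sign e x)))

  bias-+ : (e : Fin n) (f g : Subset n → ℤ) → bias e (λ x → f x + g x) ≡ bias e f + bias e g
  bias-+ e f g = trans (bias-sign e (λ x → f x + g x))
    (trans (total-cong (λ x → ℤ.*-distribʳ-+ (sign e x) (f x) (g x)))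
      (trans (total-+ (λ x → f x * sign e x) (λ x → g x * sign e x))
        (sym (cong₂ _+_ (bias-sign e f) (bias-sign e g)))))

  -- Adding the bias cancels the points that contain e and doubles the others, which form half of
  -- the cube. The bound `B` is arbitrary because the recursion passes to `plus f`, bounded by B +
  -- B.
  bias-upper : ∀ {B} (e : Fin n) (f : Subset n → ℤ) → (∀ x → f x ≤ B) → total f + bias e f ≤ B * cubeSize n
  bias-upper {suc n} {B} zero f f≤B = begin
    total (lo f) + total (hi f) + total (minus f)
      ≡⟨ cong (λ t → total (lo f) + total (hi f) + t) (total-- (lo f) (hi f)) ⟩
    total (lo f) + total (hi f) + (total (lo f) - total (hi f))
      ≡⟨ cancel (total (lo f)) (total (hi f)) ⟩
    total (lo f) + total (lo f)
      ≤⟨ ℤ.+-mono-≤ lo≤B lo≤B ⟩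
    total {n} (λ _ → B) + total {n} (λ _ → B)
      ≡⟨ total-const (suc n) B ⟩
    B * cubeSize (suc n) ∎
    where
    open ℤ.≤-Reasoning
    lo≤B : total (lo f) ≤ total {n} (λ _ → B)
    lo≤B = total-mono (λ x → f≤B (outside ∷ x))
    cancel : ∀ a b → a + b + (a - b) ≡ a + a
    cancel = solve-∀
  bias-upper {suc n} {B} (suc e) f f≤B = begin
    total (lo f) + total (hi f) + bias e (plus f)
      ≡⟨ cong (_+ bias e (plus f)) (total-+ (lo f) (hi f)) ⟨
    total (plus f) + bias e (plus f)
      ≤⟨ bias-upper e (plus f) (λ x → ℤ.+-mono-≤ (f≤B (outside ∷ x)) (f≤B (inside ∷ x))) ⟩
    (B + B) * cubeSize n
      ≡⟨ double B (cubeSize n) ⟩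
    B * (+ 2 * cubeSize n)
      ≡⟨ cong (B *_) (cubeSize-suc n) ⟨
    B * cubeSize (suc n) ∎
    where
    open ℤ.≤-Reasoning
    double : ∀ B N → (B + B) * N ≡ B * (+ 2 * N)
    double = solve-∀

  totalBias : (Subset n → ℤ) → ℤ
  totalBias f = sum (λ e → bias e f)

  totalBias-+ : (f g : Subset n → ℤ) → totalBias (λ x → f x + g x) ≡ totalBias f + totalBias g
  totalBias-+ f g = trans (sum-cong-≗ (λ e → bias-+ e f g)) (∑-distrib-+ (λ e → bias e f) (λ e → bias e g))

  -- Edge boundary of an indicator

  -- For an indicator function, the number of members covered by x.
  lower : (Subset n → ℤ) → Subset n → ℤ
  lower f []            = 0ℤ
  lower f (outside ∷ x) = lower (lo f) x
  lower f (inside ∷ x)  = lower (hi f) x + lo f x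

  -- The boundary edges of an indicator either leave the family upwards (counted by lower)
  -- or downwards, and the difference of the two numbers is the total bias.
  energy-indicator : (f : Subset n → ℤ) → (∀ x → f x * f x ≡ f x) →
    energy f ≡ + 2 * total (λ x → (1ℤ - f x) * lower f x) - totalBias f
  energy-indicator {zero}  f idem = sym (vanish (f []))
    where
    vanish : ∀ a → + 2 * ((1ℤ - a) * 0ℤ) - 0ℤ ≡ 0ℤ
    vanish = solve-∀
  energy-indicator {suc n} f idem = begin
    energy (lo f) + energy (hi f) + sqNorm (minus f)
      ≡⟨ cong₂ _+_ (cong₂ _+_ (energy-indicator (lo f) (λ x → idem (outside ∷ x)))
                              (energy-indicator (hi f) (λ x → idem (inside ∷ x)))) boundary ⟩
    (+ 2 * A₀ - totalBias (lo f)) + (+ 2 * A₁ - totalBias (hi f)) + (+ 2 * C - total (minus f))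
      ≡⟨ regroup A₀ A₁ C (totalBias (lo f)) (totalBias (hi f)) (total (minus f)) ⟩
    + 2 * (A₀ + (A₁ + C)) - (total (minus f) + (totalBias (lo f) + totalBias (hi f)))
      ≡⟨ cong₂ (λ a l → + 2 * (A₀ + a) - (total (minus f) + l)) upper (sym (totalBias-+ (lo f) (hi f))) ⟩
    + 2 * total (λ x → (1ℤ - f x) * lower f x) - totalBias f ∎
    where
    open ≡-Reasoning
    A₀ A₁ C : ℤ
    A₀ = total (λ x → (1ℤ - lo f x) * lower (lo f) x)
    A₁ = total (λ x → (1ℤ - hi f x) * lower (hi f) x)
    C  = total (λ x → (1ℤ - hi f x) * lo f x)
    regroup : ∀ a b c k l t → (+ 2 * a - k) + (+ 2 * b - l) + (+ 2 * c - t) ≡ + 2 * (a + (b + c)) - (t + (k + l))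
    regroup = solve-∀
    upper : A₁ + C ≡ total (λ x → (1ℤ - hi f x) * (lower (hi f) x + lo f x))
    upper = trans (sym (total-+ (λ x → (1ℤ - hi f x) * lower (hi f) x) (λ x → (1ℤ - hi f x) * lo f x)))
      (total-cong (λ x → sym (ℤ.*-distribˡ-+ (1ℤ - hi f x) (lower (hi f) x) (lo f x))))
    expand : ∀ a b → (a - b) * (a - b) ≡ a * a - + 2 * (a * b) + b * b
    expand = solve-∀
    collect : ∀ a b → a - + 2 * (a * b) + b ≡ + 2 * ((1ℤ - b) * a) - (a - b)
    collect = solve-∀
    -- For an edge in the first direction, `(1ℤ - hi f x) * lo f x` is 1 exactly when it leaves the
    -- family upwards. Doubling this and subtracting the signed difference counts either kind of
    -- boundary edge once.
    pointwise : ∀ x → minus f x * minus f x ≡ + 2 * ((1ℤ - hi f x) * lo f x) - minus f x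
    pointwise x = trans (expand (lo f x) (hi f x))
      (trans (cong₂ (λ u v → u - + 2 * (lo f x * hi f x) + v) (idem (outside ∷ x)) (idem (inside ∷ x)))
        (collect (lo f x) (hi f x)))
    boundary : sqNorm (minus f) ≡ + 2 * C - total (minus f)
    boundary = trans (total-cong pointwise)
      (trans (total-- (λ x → + 2 * ((1ℤ - hi f x) * lo f x)) (minus f))
        (cong (_- total (minus f)) (total-* (+ 2) (λ x → (1ℤ - hi f x) * lo f x))))

  -- Union-closed indicators

  ∪-closed : (Subset n → Bool) → Set
  ∪-closed b = ∀ x y → b x ≡ true → b y ≡ true → b (x ∪ y) ≡ true

  -- Every point that x covers is a subset of x. Containment is written `y ∪ x ≡ x`, the form to
  -- which union-closure applies directly in `lower≤1`.
  lower-none : (b : Subset n → Bool) (x : Subset n) →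
    (∀ y → b y ≡ true → y ∪ x ≡ x → ⊥) → lower (χ ∘ b) x ≡ 0ℤ
  lower-none b []            none = refl
  lower-none b (outside ∷ x) none =
    lower-none (λ y → b (outside ∷ y)) x (λ y by eq → none (outside ∷ y) by (cong (outside ∷_) eq))
  lower-none b (inside ∷ x)  none = cong₂ _+_
    (lower-none (λ y → b (inside ∷ y)) x (λ y by eq → none (inside ∷ y) by (cong (inside ∷_) eq)))
    (cong χ (Bool.¬-not (λ bx → none (outside ∷ x) bx (cong (inside ∷_) (∪-idem x)))))

  -- Two different members covered by x have union x, which would make x a member.
  lower≤1 : (b : Subset n → Bool) → ∪-closed b → ∀ x → b x ≡ false → lower (χ ∘ b) x ≤ 1ℤ
  lower≤1 b uc []            bx = +≤+ z≤n
  lower≤1 b uc (outside ∷ x) bx =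
    lower≤1 (λ y → b (outside ∷ y)) (λ y z → uc (outside ∷ y) (outside ∷ z)) x bx
  lower≤1 b uc (inside ∷ x)  bx with b (outside ∷ x) in bx₀
  ... | false = subst (_≤ 1ℤ) (sym (ℤ.+-identityʳ _))
    (lower≤1 (λ y → b (inside ∷ y)) (λ y z → uc (inside ∷ y) (inside ∷ z)) x bx)
  -- The member `outside ∷ x` joined with a member `inside ∷ y` for y ⊆ x gives `inside ∷ x`, so no
  -- further member is covered.
  ... | true  = ℤ.≤-reflexive (cong (_+ 1ℤ) (lower-none (λ y → b (inside ∷ y)) x covered))
    where
    covered : ∀ y → b (inside ∷ y) ≡ true → y ∪ x ≡ x → ⊥
    covered y by eq with () ← trans (sym bx) (subst (λ z → b (inside ∷ z) ≡ true) eq (uc (inside ∷ y) (outside ∷ x) by bx₀))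

  nonmembers : (b : Subset n → Bool) → total (λ x → 1ℤ - χ (b x)) ≡ cubeSize n - total (χ ∘ b)
  nonmembers {n} b = trans (total-- (λ _ → 1ℤ) (χ ∘ b))
    (cong (_- total (χ ∘ b)) (trans (total-const n 1ℤ) (ℤ.*-identityˡ (cubeSize n))))

  0≤nonmembers : (b : Subset n → Bool) → 0ℤ ≤ cubeSize n - total (χ ∘ b)
  0≤nonmembers {n} b = subst (_≤ cubeSize n - total (χ ∘ b)) (total-0 {n})
    (subst (total {n} (λ _ → 0ℤ) ≤_) (nonmembers b) (total-mono (λ x → ℤ.i≤j⇒0≤j-i (χ≤1 (b x)))))

  upEdges≤nonmembers : (b : Subset n → Bool) → ∪-closed b →
    total (λ x → (1ℤ - χ (b x)) * lower (χ ∘ b) x) ≤ cubeSize n - total (χ ∘ b)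
  upEdges≤nonmembers {n} b uc = subst (total (λ x → (1ℤ - χ (b x)) * lower (χ ∘ b) x) ≤_) (nonmembers b) (total-mono pointwise)
    where
    pointwise : ∀ x → (1ℤ - χ (b x)) * lower (χ ∘ b) x ≤ 1ℤ - χ (b x)
    pointwise x with b x in bx
    ... | true  = ℤ.≤-refl
    ... | false = subst (_≤ 1ℤ) (sym (ℤ.*-identityˡ (lower (χ ∘ b) x))) (lower≤1 b uc x bx)

  -- Write s, L, W for the total, the total bias and the linear weight. The bound 2 (N - s) - L on
  -- the energy turns the level-one inequality into 0 ≤ 2 W - N L + 2 (N - s) (N - 2 s), and density
  -- makes the last product nonpositive.
  totalBias≤linearWeight : (b : Subset n → Bool) → ∪-closed b → cubeSize n < + 2 * total (χ ∘ b) →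
    cubeSize n * totalBias (χ ∘ b) ≤ + 2 * linearWeight (χ ∘ b)
  totalBias≤linearWeight {n} b uc N<2s = ℤ.0≤i-j⇒j≤i {+ 2 * linearWeight f} {N * totalBias f}
    (subst (0ℤ ≤_) (combine N s A (totalBias f) (linearWeight f) (energy f) (sqNorm f)
        (energy-indicator f (χ-idem ∘ b)) (total-cong (χ-idem ∘ b)))
      (0≤+ (0≤+ (level-one-inequality f)
                (0≤* (+≤+ (z≤n {2})) (0≤* (0≤cubeSize n) (ℤ.i≤j⇒0≤j-i (upEdges≤nonmembers b uc)))))
           (0≤* (+≤+ (z≤n {2})) (0≤* (0≤nonmembers b) (ℤ.i≤j⇒0≤j-i (ℤ.<⇒≤ N<2s))))))
    where
    f : Subset n → ℤ
    f = χ ∘ b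
    N s A : ℤ
    N = cubeSize n
    s = total f
    A = total (λ x → (1ℤ - f x) * lower f x)
    identity : ∀ N s A L W →
      (N * (+ 2 * A - L) + + 2 * W + + 4 * (s * s) - + 4 * (N * s)) + + 2 * (N * (N - s - A)) + + 2 * ((N - s) * (+ 2 * s - N))
        ≡ + 2 * W - N * L
    identity = solve-∀
    combine : ∀ N s A L W E Q → E ≡ + 2 * A - L → Q ≡ s →
      (N * E + + 2 * W + + 4 * (s * s) - + 4 * (N * Q)) + + 2 * (N * (N - s - A)) + + 2 * ((N - s) * (+ 2 * s - N))
        ≡ + 2 * W - N * L
    combine N s A L W _ _ refl refl = identity N s A L W

  -- Both c e and N - 2 c e are positive integers, so each of the k summands c e (N - 2 c e) is at
  -- least 1.
  sum-gap : ∀ k N (c : Fin k → ℤ) → (∀ e → 0ℤ < c e) → (∀ e → + 2 * c e < N) →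
    + k ≤ N * sum c - + 2 * sum (λ e → c e * c e)
  sum-gap zero    N c pos small = ℤ.≤-reflexive (sym (vanish N))
    where
    vanish : ∀ N → N * 0ℤ - + 2 * 0ℤ ≡ 0ℤ
    vanish = solve-∀
  sum-gap (suc k) N c pos small =
    subst (1ℤ + + k ≤_) (split N (c zero) (sum (c ∘ suc)) (sum (λ e → c (suc e) * c (suc e))))
      (ℤ.+-mono-≤ {1ℤ} {c zero * (N - + 2 * c zero)} head (sum-gap k N (c ∘ suc) (pos ∘ suc) (small ∘ suc)))
    where
    split : ∀ N a S T → a * (N - + 2 * a) + (N * S - + 2 * T) ≡ N * (a + S) - + 2 * (a * a + T)
    split = solve-∀
    product : ∀ N a → (a - 1ℤ) * (N - + 2 * a) + (N - (1ℤ + + 2 * a)) ≡ a * (N - + 2 * a) - 1ℤ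
    product = solve-∀
    head : 1ℤ ≤ c zero * (N - + 2 * c zero)
    head = ℤ.0≤i-j⇒j≤i {c zero * (N - + 2 * c zero)} {1ℤ} (subst (0ℤ ≤_) (product N (c zero))
      (0≤+ (0≤* (ℤ.i≤j⇒0≤j-i (ℤ.i<j⇒suc[i]≤j (pos zero))) (ℤ.i≤j⇒0≤j-i (ℤ.<⇒≤ (small zero))))
        (ℤ.i≤j⇒0≤j-i (ℤ.i<j⇒suc[i]≤j (small zero)))))

  dense⇒someBias≤0 : (b : Subset (suc n) → Bool) → ∪-closed b → cubeSize (suc n) < + 2 * total (χ ∘ b) →
    ¬ (∀ e → 0ℤ < bias e (χ ∘ b))
  dense⇒someBias≤0 {n} b uc N<2s pos =
    -- The gap is at least the size of the ground set, which is positive here, while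
    -- `totalBias≤linearWeight` makes it at most 0.
    contradiction (ℤ.≤-trans gap (ℤ.i≤j⇒i-j≤0 (totalBias≤linearWeight b uc N<2s))) λ { (+≤+ ()) }
    where
    f : Subset (suc n) → ℤ
    f = χ ∘ b
    shift : ∀ s c → + 2 * c ≡ + 2 * (s + c) - + 2 * s
    shift = solve-∀
    unshift : ∀ N → + 2 * (1ℤ * N) - N ≡ N
    unshift = solve-∀
    -- `bias-upper` with bound 1 gives s + c ≤ N, whence 2 c ≤ 2 N - 2 s < N by density.
    small : ∀ e → + 2 * bias e f < cubeSize (suc n)
    small e = begin-strict
      + 2 * bias e f
        ≡⟨ shift (total f) (bias e f) ⟩
      + 2 * (total f + bias e f) - + 2 * total f
        <⟨ ℤ.+-mono-≤-< (ℤ.*-monoˡ-≤-nonNeg (+ 2) (bias-upper e f (χ≤1 ∘ b))) (ℤ.neg-mono-< N<2s) ⟩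
      + 2 * (1ℤ * cubeSize (suc n)) - cubeSize (suc n)
        ≡⟨ unshift (cubeSize (suc n)) ⟩
      cubeSize (suc n) ∎
      where open ℤ.≤-Reasoning
    gap : + suc n ≤ cubeSize (suc n) * totalBias f - + 2 * linearWeight f
    gap = sum-gap (suc n) (cubeSize (suc n)) (λ e → bias e f) pos small

  -- Families as indicator functions

  _≟_ : DecidableEquality (Subset n)
  _≟_ = ≡-dec Bool._≟_

  _∈ₗ?_ : (x : Subset n) (xs : List (Subset n)) → Dec (x ∈ₗ xs)
  _∈ₗ?_ = DecMembership._∈?_ _≟_

  member : List (Subset n) → Subset n → Bool
  member xs x = does (x ∈ₗ? xs)

  sumOver : (Subset n → ℤ) → List (Subset n) → ℤ
  sumOver w = foldr (λ x t → w x + t) 0ℤ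

  total-point : (y : Subset n) (w : Subset n → ℤ) → total (λ x → χ (does (x ≟ y)) * w x) ≡ w y
  total-point []            w = ℤ.*-identityˡ (w [])
  total-point {suc n} (outside ∷ y) w = trans (cong₂ _+_ (total-point y (lo w)) (total-0 {n})) (ℤ.+-identityʳ (lo w y))
  total-point {suc n} (inside ∷ y)  w = trans (cong₂ _+_ (total-0 {n}) (total-point y (hi w))) (ℤ.+-identityˡ (hi w y))

  -- Distinctness makes the indicator of `y ∷ xs` a point mass at y plus the indicator of xs. The
  -- weight lets one identity serve two counts: the constant 1 yields `m`, and `sign e` yields `mₑ`.
  total-member : {xs : List (Subset n)} → Unique xs → (w : Subset n → ℤ) →
    total (λ x → χ (member xs x) * w x) ≡ sumOver w xs
  total-member {n}      []             w = total-0 {n}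
  total-member {n} {y ∷ xs} (y≢xs ∷ unique) w =
    trans (total-cong pointwise)
      (trans (total-+ (λ x → χ (does (x ≟ y)) * w x) (λ x → χ (member xs x) * w x))
        (cong₂ _+_ (total-point y w) (total-member unique w)))
    where
    disjoint : ∀ x → χ (member (y ∷ xs) x) ≡ χ (does (x ≟ y)) + χ (member xs x)
    disjoint x with x ≟ y
    ... | no  _    = sym (ℤ.+-identityˡ (χ (member xs x)))
    ... | yes refl rewrite dec-false (x ∈ₗ? xs) (All¬⇒¬Any y≢xs) = refl
    pointwise : ∀ x → χ (member (y ∷ xs) x) * w x ≡ χ (does (x ≟ y)) * w x + χ (member xs x) * w x
    pointwise x = trans (cong (_* w x) (disjoint x)) (ℤ.*-distribʳ-+ (w x) (χ (does (x ≟ y))) (χ (member xs x)))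

  indicator : Family n → Subset n → Bool
  indicator F = member (sets F)

  indicator-∪-closed : (F : Family n) → UnionClosed F → ∪-closed (indicator F)
  indicator-∪-closed F uc x y bx by = dec-true ((x ∪ y) ∈ₗ? sets F) (uc (sound x bx) (sound y by))
    where
    sound : ∀ z → indicator F z ≡ true → z ∈ₗ sets F
    sound z bz with yes z∈F ← z ∈ₗ? sets F = z∈F

  total-indicator : (F : Family n) → total (χ ∘ indicator F) ≡ + m F
  total-indicator F = trans (total-cong (λ x → sym (ℤ.*-identityʳ (χ (indicator F x)))))
    (trans (total-member (distinct F) (λ _ → 1ℤ)) (count (sets F)))
    where
    count : (xs : List (Subset n)) → sumOver (λ _ → 1ℤ) xs ≡ + length xs
    count []       = refl
    count (x ∷ xs) = cong (λ t → 1ℤ + t) (count xs)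

  bias-indicator : (F : Family n) (e : Fin n) → bias e (χ ∘ indicator F) ≡ + m F - + 2 * + mₑ F e
  bias-indicator F e = trans (bias-sign e (χ ∘ indicator F))
    (trans (total-member (distinct F) (sign e)) (count (sets F)))
    where
    outsideStep : ∀ a b → (1ℤ - + 2 * 0ℤ) + (a - + 2 * b) ≡ (1ℤ + a) - + 2 * b
    outsideStep = solve-∀
    insideStep : ∀ a b → (1ℤ - + 2 * 1ℤ) + (a - + 2 * b) ≡ (1ℤ + a) - + 2 * (1ℤ + b)
    insideStep = solve-∀
    count : (xs : List (Subset _)) → sumOver (sign e) xs ≡ + length xs - + 2 * + length (filter (e ∈?_) xs)
    count []       = refl
    count (x ∷ xs) with does (e ∈? x)
    ... | false = trans (cong (λ t → 1ℤ - + 2 * 0ℤ + t) (count xs)) (outsideStep (+ length xs) (+ length (filter (e ∈?_) xs)))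
    ... | true  = trans (cong (λ t → 1ℤ - + 2 * 1ℤ + t) (count xs)) (insideStep (+ length xs) (+ length (filter (e ∈?_) xs)))

  m≤2^n : (F : Family n) → m F ℕ.≤ 2 ^ n
  m≤2^n {n} F = ℤ.drop‿+≤+ (subst (_≤ cubeSize n) (total-indicator F) (ℤ.0≤i-j⇒j≤i {cubeSize n} {total (χ ∘ indicator F)} (0≤nonmembers (indicator F))))

  -- If every element failed, every bias m - 2 mₑ would be positive, against `dense⇒someBias≤0`. The
  -- search over a finite ground set is decidable, so this refutation produces a witness.
  dense⇒half : (F : Family n) → UnionClosed F → 2 ℕ.≤ m F → 2 ^ n ℕ.< 2 ℕ.* m F → ∃ λ e → m F ℕ.≤ 2 ℕ.* mₑ F e
  dense⇒half {zero}  F uc 2≤m dense = contradiction (ℕ.≤-trans 2≤m (m≤2^n F)) λ { (s≤s ()) }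
  dense⇒half {suc n} F uc 2≤m dense = decidable-stable (any? (λ e → m F ℕ.≤? 2 ℕ.* mₑ F e)) λ none →
    dense⇒someBias≤0 (indicator F) (indicator-∪-closed F uc)
      (subst (cubeSize (suc n) <_) (trans (ℤ.pos-* 2 (m F)) (cong (+ 2 *_) (sym (total-indicator F)))) (+<+ dense))
      (λ e → subst (0ℤ <_)
        (trans (cong (λ t → + m F - t) (ℤ.pos-* 2 (mₑ F e))) (sym (bias-indicator F e)))
        (0<difference (ℕ.≰⇒> (λ half → none (e , half)))))
    where
    0<difference : ∀ {a b} → a ℕ.< b → 0ℤ < + b - + a
    0<difference {a} {b} a<b = subst (_< + b - + a) (ℤ.+-inverseʳ (+ a)) (ℤ.+-monoˡ-< (- + a) (+<+ a<b))

-- Reduction to a dense extremal family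

open Cube using (dense⇒half; m≤2^n)
open import Data.Nat using (_≤_; _<_; _+_; _*_)

maximum : (h : Fin (suc n) → ℕ) → ∃ λ e → ∀ e′ → h e′ ≤ h e
maximum {zero}  h = zero , λ { zero → ℕ.≤-refl }
maximum {suc n} h with maximum (h ∘ suc)
... | e , max with h zero ℕ.≤? h (suc e)
...   | yes h₀≤ = suc e , λ { zero → h₀≤ ; (suc e′) → max e′ }
...   | no  h₀≰ = zero , λ { zero → ℕ.≤-refl ; (suc e′) → ℕ.≤-trans (max e′) (ℕ.<⇒≤ (ℕ.≰⇒> h₀≰)) }

-- For an undecided `P` strong induction gives a least element only under double negation, which is
-- enough for a decidable goal.
¬¬-least : (P : ℕ → Set) → ∀ {k} → P k → ¬ ¬ ∃ λ j → P j × (∀ i → P i → j ≤ i)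
¬¬-least P {k} Pk noLeast = <-rec (λ k → ¬ P k) step k Pk
  where
  step : ∀ k → (∀ {i} → i < k → ¬ P i) → ¬ P k
  step k below Pk = noLeast (k , Pk , λ i Pi → ℕ.≮⇒≥ (λ i<k → below i<k Pi))

1≤⌈log₂⌉ : ∀ k → 2 ≤ k → 1 ≤ ⌈log₂ k ⌉
1≤⌈log₂⌉ k 2≤k = ⌈log₂⌉-mono-≤ {2} {k} 2≤k

-- For a positive exponent, k ≤ 2ⁿ⁻¹ would force ⌈log₂ k⌉ ≤ n - 1.
n≤⌈log₂⌉⇒2^n<2* : ∀ n k → 1 ≤ k → n ≤ ⌈log₂ k ⌉ → 2 ^ n < 2 * k
n≤⌈log₂⌉⇒2^n<2* zero    k 1≤k n≤log = ℕ.*-monoʳ-≤ 2 1≤k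
n≤⌈log₂⌉⇒2^n<2* (suc n) k 1≤k n≤log = ℕ.*-monoʳ-< 2 {2 ^ n} {k} (ℕ.≰⇒> λ k≤2^n →
  ℕ.<⇒≱ n≤log (subst (⌈log₂ k ⌉ ≤_) (⌈log₂2^n⌉≡n n) (⌈log₂⌉-mono-≤ {k} {2 ^ n} k≤2^n)))

-- One half exceeds 6/13, since 12 ≤ 13. Keeping c and d apart allows c to be the value of `g` and d
-- the largest frequency in a given family.
half⇒6/13 : ∀ {k d} c → k ≤ 2 * c → c ≤ d → 6 * k ≤ 13 * d
half⇒6/13 {k} {d} c k≤2c c≤d = begin
  6 * k       ≤⟨ ℕ.*-monoʳ-≤ 6 k≤2c ⟩
  6 * (2 * c) ≡⟨ ℕ.*-assoc 6 2 c ⟨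
  12 * c      ≤⟨ ℕ.*-mono-≤ (ℕ.n≤1+n 12) c≤d ⟩
  13 * d      ∎
  where open ℕ.≤-Reasoning

dense⇒6/13 : (F : Family n) → UnionClosed F → 2 ≤ m F → 2 ^ n < 2 * m F → ∃ λ e → 6 * m F ≤ 13 * mₑ F e
dense⇒6/13 F uc 2≤m dense = map₂ (λ {e} half → half⇒6/13 {m F} {mₑ F e} (mₑ F e) half ℕ.≤-refl) (dense⇒half F uc 2≤m dense)

-- Assumption (ii): as `g` is given by a relation, equality of its values reads as an equivalence.
G-Stable : Set
G-Stable = ∀ (n mm : ℕ) → 1 ≤ n → 2 ≤ mm → ⌈log₂ mm ⌉ ≤ n →
  ∀ k → (IsG n mm k → IsG (suc n) mm k) × (IsG (suc n) mm k → IsG n mm k)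

descend : G-Stable → ∀ {mm n g} d → 1 ≤ n → 2 ≤ mm → ⌈log₂ mm ⌉ ≤ n → IsG (d + n) mm g → IsG n mm g
descend stable zero    1≤n 2≤mm log≤n isG = isG
descend stable {mm} {n} {g} (suc d) 1≤n 2≤mm log≤n isG = descend stable d 1≤n 2≤mm log≤n
  (proj₂ (stable (d + n) mm (ℕ.m≤n⇒m≤o+n d 1≤n) 2≤mm (ℕ.m≤n⇒m≤o+n d log≤n) g) isG)

-- The family attaining the minimum is itself dense, so `dense⇒half` applies to it, and none of its
-- frequencies exceeds g.
IsG⇒half : ∀ {n mm g} → IsG n mm g → 2 ≤ mm → 2 ^ n < 2 * mm → mm ≤ 2 * g
IsG⇒half ((F , uc , refl , _ , max) , _) 2≤m dense with e , half ← dense⇒half F uc 2≤m dense =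
  ℕ.≤-trans half (ℕ.*-monoʳ-≤ 2 (max e))

-- F itself need not be dense, but its largest frequency is at least the value of `g` on its ground
-- set. Stability gives the same value on k elements, where a minimiser is dense.
sparse⇒6/13 : G-Stable → ∀ {n} (F : Family (suc n)) → UnionClosed F → 2 ≤ m F →
  ∀ k → 1 ≤ k → ⌈log₂ m F ⌉ ≤ k → 2 ^ k < 2 * m F → k ≤ suc n → ∃ λ e → 6 * m F ≤ 13 * mₑ F e
sparse⇒6/13 stable {n} F uc 2≤m k 1≤k log≤k dense k≤n =
  -- The witness is chosen outright as a most frequent element; only the decidable inequality is
  -- argued by contradiction, where the least frequency from `¬¬-least` becomes available.
  e , decidable-stable (6 * m F ℕ.≤? 13 * mₑ F e) λ fails →
    ¬¬-least Attained attainedF λ (g , attained , least) →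
      let isG : IsG (suc n) (m F) g
          isG = attained , λ F′ uc′ size j isA → least j (F′ , uc′ , size , isA)
          isGᵏ : IsG k (m F) g
          isGᵏ = descend stable (suc n ℕ.∸ k) 1≤k 2≤m log≤k (subst (λ n → IsG n (m F) g) (sym (ℕ.m∸n+n≡m k≤n)) isG)
      in fails (half⇒6/13 g (IsG⇒half isGᵏ 2≤m dense) (least (mₑ F e) attainedF))
  where
  e : Fin (suc n)
  e = proj₁ (maximum (mₑ F))
  Attained : ℕ → Set
  Attained j = Σ (Family (suc n)) λ F′ → UnionClosed F′ × m F′ ≡ m F × IsA F′ j
  attainedF : Attained (mₑ F e)
  attainedF = F , uc , refl , (e , refl) , proj₂ (maximum (mₑ F))

theorem2p6 : (∀ (n a : ℕ) → 1 ≤ n → 1 ≤ a → ⌈log₂ a ⌉ + 1 ≤ n →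
    ∀ k → (IsF n a k → IsF (suc n) a k) × (IsF (suc n) a k → IsF n a k)) →
    (∀ (n mm : ℕ) → 1 ≤ n → 2 ≤ mm → ⌈log₂ mm ⌉ ≤ n →
    ∀ k → (IsG n mm k → IsG (suc n) mm k) × (IsG (suc n) mm k → IsG n mm k)) →
    ∀ (n : ℕ) (F : Family n) → UnionClosed F → 2 ≤ m F →
    ∃ λ e → 6 * m F ≤ 13 * mₑ F e
theorem2p6 _ _ zero F uc 2≤m = contradiction (ℕ.≤-trans 2≤m (m≤2^n F)) λ { (s≤s ()) }
theorem2p6 _ stable (suc n) F uc 2≤m with ℕ.≤-total (suc n) ⌈log₂ m F ⌉
... | inj₁ n≤log = dense⇒6/13 F uc 2≤m (n≤⌈log₂⌉⇒2^n<2* (suc n) (m F) (ℕ.<⇒≤ 2≤m) n≤log)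
-- ⌈log₂ m⌉ is the smallest ground set within reach of stability, and it is small enough for
-- density.
... | inj₂ log≤n = sparse⇒6/13 stable F uc 2≤m ⌈log₂ m F ⌉ (1≤⌈log₂⌉ (m F) 2≤m) ℕ.≤-refl
  (n≤⌈log₂⌉⇒2^n<2* ⌈log₂ m F ⌉ (m F) (ℕ.<⇒≤ 2≤m) ℕ.≤-refl) log≤n
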